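{- Let $(B,\wedge,-,0,1)$ and $(B',\vee',-',0',1')$ be two Boolean algebras, let $A$ be a set, and let $r:A\to B$, $e:B\to A$, $r':A\to B'$, $e':B'\to A$ be maps such that $r\circ e=\mathrm{id}_B$ and $r'\circ e'=\mathrm{id}_{B'}$. Let $\mathbf A:=(A,\sqcap,\sqcup,\bar\neg,\lrcorner,e'(1'),e(0))$ be the algebra with $x\sqcap y:=e(r(x)\wedge r(y))$, $x\sqcup y:=e'(r'(x)\vee' r'(y))$, $\bar\neg x:=e(-r(x))$ and $\lrcorner x:=e'(-'r'(x))$, top constant $e'(1')$ and bottom constant $e(0)$. Then $\mathbf A$ is a double Boolean algebra if and only if the following hold: (a) $e\circ r\circ e'\circ r'=e'\circ r'\circ e\circ r$; (b) $e(r(x)\wedge r(e'(r'(x)\vee' r'(y))))=e(r(x))$ and $e'(r'(x)\vee' r'(e(r(x)\wedge r(y))))=e'(r'(x))$ for all $x,y\in A$; (c) $r(e'(1'))=1$ and $r'(e(0))=0'$. Moreover, every double Boolean algebra can be obtained from such a construction; that is, for every double Boolean algebra $\mathbf D$ with carrier $D$ there are Boolean algebras $(B,\wedge,-,0,1)$ and $(B',\vee',-',0',1')$ and maps $r:D\to B$, $e:B\to D$, $r':D\to B'$, $e':B'\to D$ with $r\circ e=\mathrm{id}_B$ and $r'\circ e'=\mathrm{id}_{B'}$, satisfying (a)–(c) with $A=D$, such that $\mathbf D$ is the resulting algebra $\mathbf A$, i.e. the operations of $\mathbf D$ are given by $x\sqcap y=e(r(x)\wedge r(y))$, $x\sqcup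 y=e'(r'(x)\vee' r'(y))$, $\bar\neg x=e(-r(x))$, $\lrcorner x=e'(-'r'(x))$, $\top=e'(1')$ and $\bot=e(0)$.
   Context: A double Boolean algebra (dBa) is an algebra $(D,\sqcup,\sqcap,\bar\neg,\lrcorner,\top,\bot)$ (with $\sqcup,\sqcap$ binary, $\bar\neg,\lrcorner$ unary, $\top,\bot$ constants) satisfying, for all $x,y,z\in D$, where $x\bar\vee y:=\bar\neg(\bar\neg x\sqcap\bar\neg y)$ and $x\bar\wedge y:=\lrcorner(\lrcorner x\sqcup\lrcorner y)$: (1a) $(x\sqcap x)\sqcap y=x\sqcap y$; (1b) $(x\sqcup x)\sqcup y=x\sqcup y$; (2a) $x\sqcap y=y\sqcap x$; (2b) $x\sqcup y=y\sqcup x$; (3a) $\bar\neg(x\sqcap x)=\bar\neg x$; (3b) $\lrcorner(x\sqcup x)=\lrcorner x$; (4a) $x\sqcap(x\sqcup y)=x\sqcap x$; (4b) $x\sqcup(x\sqcap y)=x\sqcup x$; (5a) $x\sqcap(y\bar\vee z)=(x\sqcap y)\bar\vee(x\sqcap z)$; (5b) $x\sqcup(y\bar\wedge z)=(x\sqcup y)\bar\wedge(x\sqcup z)$; (6a) $x\sqcap(x\bar\vee y)=x\sqcap x$; (6b) $x\sqcup(x\bar\wedge y)=x\sqcup x$; (7a) $\bar\neg\bar\neg(x\sqcap y)=x\sqcap y$; (7b) $\lrcorner\lrcorner(x\sqcup y)=x\sqcup y$; (8a) $x\sqcap\bar\neg x=\bot$; (8b) $x\sqcup\lrcorner x=\top$;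 (9a) $\bar\neg\top=\bot$; (9b) $\lrcorner\bot=\top$; (10a) $x\sqcap(y\sqcap z)=(x\sqcap y)\sqcap z$; (10b) $x\sqcup(y\sqcup z)=(x\sqcup y)\sqcup z$; (11a) $\bar\neg\bot=\top\sqcap\top$; (11b) $\lrcorner\top=\bot\sqcup\bot$; (12) $(x\sqcap x)\sqcup(x\sqcap x)=(x\sqcup x)\sqcap(x\sqcup x)$. In $(B,\wedge,-,0,1)$, $\wedge$ is meet, $-$ complement, $0$ and $1$ least and greatest elements; in $(B',\vee',-',0',1')$, $\vee'$ is join, $-'$ complement, $0'$ and $1'$ least and greatest elements. -}

module Defs where

open import Level using (Level; suc) renaming (_⊔_ to _⊔ˡ_)
open import Algebra.Core using (Op₁; Op₂)
open import Algebra.Definitions using (Congruent₁; Congruent₂)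
open import Algebra.Lattice.Bundles using (BooleanAlgebra)
open import Function.Bundles using (Func)
open import Relation.Binary.Bundles using (Setoid)
open import Relation.Binary.Core using (Rel)
open import Relation.Binary.Structures using (IsEquivalence)

-- As in the standard library's algebra hierarchy, sets are setoids: equality
-- of elements is _≈_, the operations respect it, and maps are the congruent
-- functions Func.

record RawDoubleBooleanAlgebra (c ℓ : Level) : Set (suc (c ⊔ˡ ℓ)) where
  infix  8 ¬_ ⌟_
  infixr 7 _⊓_ _∧_
  infixr 6 _⊔_ _∨_
  infix  4 _≈_
  field
    Carrier : Set c
    _≈_     : Rel Carrier ℓ
    _⊔_     : Op₂ Carrier
    _⊓_     : Op₂ Carrier
    ¬_      : Op₁ Carrier
    ⌟_      : Op₁ Carrier
    ⊤       : Carrier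
    ⊥       : Carrier

  _∨_ : Op₂ Carrier
  x ∨ y = ¬ (¬ x ⊓ ¬ y)

  _∧_ : Op₂ Carrier
  x ∧ y = ⌟ (⌟ x ⊔ ⌟ y)

record IsDoubleBooleanAlgebra
  {c ℓ : Level} (D : RawDoubleBooleanAlgebra c ℓ) : Set (c ⊔ˡ ℓ) where

  open RawDoubleBooleanAlgebra D

  field
    isEquivalence : IsEquivalence _≈_
    ⊔-cong        : Congruent₂ _≈_ _⊔_
    ⊓-cong        : Congruent₂ _≈_ _⊓_
    ¬-cong        : Congruent₁ _≈_ ¬_
    ⌟-cong        : Congruent₁ _≈_ ⌟_

    ax1a  : ∀ x y → (x ⊓ x) ⊓ y ≈ x ⊓ y
    ax1b  : ∀ x y → (x ⊔ x) ⊔ y ≈ x ⊔ y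
    ax2a  : ∀ x y → x ⊓ y ≈ y ⊓ x
    ax2b  : ∀ x y → x ⊔ y ≈ y ⊔ x
    ax3a  : ∀ x → ¬ (x ⊓ x) ≈ ¬ x
    ax3b  : ∀ x → ⌟ (x ⊔ x) ≈ ⌟ x
    ax4a  : ∀ x y → x ⊓ (x ⊔ y) ≈ x ⊓ x
    ax4b  : ∀ x y → x ⊔ (x ⊓ y) ≈ x ⊔ x
    ax5a  : ∀ x y z → x ⊓ (y ∨ z) ≈ (x ⊓ y) ∨ (x ⊓ z)
    ax5b  : ∀ x y z → x ⊔ (y ∧ z) ≈ (x ⊔ y) ∧ (x ⊔ z)
    ax6a  : ∀ x y → x ⊓ (x ∨ y) ≈ x ⊓ x
    ax6b  : ∀ x y → x ⊔ (x ∧ y) ≈ x ⊔ x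
    ax7a  : ∀ x y → ¬ (¬ (x ⊓ y)) ≈ x ⊓ y
    ax7b  : ∀ x y → ⌟ (⌟ (x ⊔ y)) ≈ x ⊔ y
    ax8a  : ∀ x → x ⊓ ¬ x ≈ ⊥
    ax8b  : ∀ x → x ⊔ ⌟ x ≈ ⊤
    ax9a  : ¬ ⊤ ≈ ⊥
    ax9b  : ⌟ ⊥ ≈ ⊤
    ax10a : ∀ x y z → x ⊓ (y ⊓ z) ≈ (x ⊓ y) ⊓ z
    ax10b : ∀ x y z → x ⊔ (y ⊔ z) ≈ (x ⊔ y) ⊔ z
    ax11a : ¬ ⊥ ≈ ⊤ ⊓ ⊤
    ax11b : ⌟ ⊤ ≈ ⊥ ⊔ ⊥
    ax12  : ∀ x → (x ⊓ x) ⊔ (x ⊓ x) ≈ (x ⊔ x) ⊓ (x ⊔ x)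

record DoubleBooleanAlgebra (c ℓ : Level) : Set (suc (c ⊔ˡ ℓ)) where
  field
    raw : RawDoubleBooleanAlgebra c ℓ
    isDoubleBooleanAlgebra : IsDoubleBooleanAlgebra raw

  open RawDoubleBooleanAlgebra raw public
  open IsDoubleBooleanAlgebra isDoubleBooleanAlgebra public

  setoid : Setoid c ℓ
  setoid = record { isEquivalence = isEquivalence }

module Construction
  {a ℓa b ℓb b′ ℓb′ : Level}
  (A : Setoid a ℓa) (B : BooleanAlgebra b ℓb) (B′ : BooleanAlgebra b′ ℓb′)
  (rᶠ : Func A (BooleanAlgebra.setoid B))
  (eᶠ : Func (BooleanAlgebra.setoid B) A)
  (r′ᶠ : Func A (BooleanAlgebra.setoid B′))
  (e′ᶠ : Func (BooleanAlgebra.setoid B′) A)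
  where

  open Setoid A using (_≈_) renaming (Carrier to ∣A∣)
  open BooleanAlgebra B using ()
    renaming (_≈_ to _≈ᴮ_; _∧_ to _∧ᴮ_; ¬_ to -_; ⊤ to 1ᴮ; ⊥ to 0ᴮ)
  open BooleanAlgebra B′ using ()
    renaming (_≈_ to _≈′_; _∨_ to _∨′_; ¬_ to -′_; ⊤ to 1′; ⊥ to 0′)
  open Func rᶠ using () renaming (to to r)
  open Func eᶠ using () renaming (to to e)
  open Func r′ᶠ using () renaming (to to r′)
  open Func e′ᶠ using () renaming (to to e′)

  record AreRetractions : Set (b ⊔ˡ ℓb ⊔ˡ b′ ⊔ˡ ℓb′) where
    field
      r∘e≈id   : ∀ p → r (e p) ≈ᴮ p
      r′∘e′≈id : ∀ q → r′ (e′ q) ≈′ q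

  result : RawDoubleBooleanAlgebra a ℓa
  result = record
    { Carrier = ∣A∣
    ; _≈_     = _≈_
    ; _⊔_     = λ x y → e′ (r′ x ∨′ r′ y)
    ; _⊓_     = λ x y → e (r x ∧ᴮ r y)
    ; ¬_      = λ x → e (- r x)
    ; ⌟_      = λ x → e′ (-′ r′ x)
    ; ⊤       = e′ 1′
    ; ⊥       = e 0ᴮ
    }

  record Conditions : Set (a ⊔ˡ ℓa ⊔ˡ ℓb ⊔ˡ ℓb′) where
    field
      a-comm : ∀ x → e (r (e′ (r′ x))) ≈ e′ (r′ (e (r x)))
      b-⊓    : ∀ x y → e (r x ∧ᴮ r (e′ (r′ x ∨′ r′ y))) ≈ e (r x)
      b-⊔    : ∀ x y → e′ (r′ x ∨′ r′ (e (r x ∧ᴮ r y))) ≈ e′ (r′ x)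
      c-⊤    : r (e′ 1′) ≈ᴮ 1ᴮ
      c-⊥    : r′ (e 0ᴮ) ≈′ 0′

-- D is the result of the construction on its own setoid: carrier and equality
-- agree by definition, so only the operations remain to be compared.
record Recovers
  {c ℓ b ℓb b′ ℓb′ : Level} (D : DoubleBooleanAlgebra c ℓ)
  (B : BooleanAlgebra b ℓb) (B′ : BooleanAlgebra b′ ℓb′)
  (r : Func (DoubleBooleanAlgebra.setoid D) (BooleanAlgebra.setoid B))
  (e : Func (BooleanAlgebra.setoid B) (DoubleBooleanAlgebra.setoid D))
  (r′ : Func (DoubleBooleanAlgebra.setoid D) (BooleanAlgebra.setoid B′))
  (e′ : Func (BooleanAlgebra.setoid B′) (DoubleBooleanAlgebra.setoid D))
  : Set (c ⊔ˡ ℓ) where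

  private
    module D = DoubleBooleanAlgebra D
    module R = RawDoubleBooleanAlgebra (Construction.result D.setoid B B′ r e r′ e′)

  field
    ⊓-eq : ∀ x y → (x D.⊓ y) D.≈ (x R.⊓ y)
    ⊔-eq : ∀ x y → (x D.⊔ y) D.≈ (x R.⊔ y)
    ¬-eq : ∀ x → (D.¬ x) D.≈ (R.¬ x)
    ⌟-eq : ∀ x → (D.⌟ x) D.≈ (R.⌟ x)
    ⊤-eq : D.⊤ D.≈ R.⊤
    ⊥-eq : D.⊥ D.≈ R.⊥

{-# OPTIONS --safe #-}
module Submission where

-- The axioms of a double Boolean algebra are invariant under exchanging ⊓, ¬, ⊤
-- with ⊔, ⌟, ⊥, so it suffices to treat the axioms (1a)–(11a) and (12).  The meet
-- part of D is a Boolean algebra once x and y are identified when x ⊓ x ≈ y ⊓ y;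
-- with this quotient for B, r is the identity and e is x ↦ x ⊓ x.

open import Defs
open import Level using (Level) renaming (_⊔_ to _⊔ˡ_)
open import Algebra.Definitions using (Congruent₁; Congruent₂)
open import Algebra.Lattice.Bundles using (BooleanAlgebra)
open import Algebra.Lattice.Structures using (IsBooleanAlgebra)
open import Algebra.Lattice.Structures.Biased
  using (isDistributiveLatticeʳʲᵐ; isBooleanAlgebraʳ)
import Algebra.Lattice.Properties.BooleanAlgebra as BooleanAlgebraProperties
open import Data.Product using (_×_; Σ-syntax; _,_)
open import Function.Bundles using (Func; _⇔_; mk⇔)
open import Relation.Binary.Bundles using (Setoid)
open import Relation.Binary.Core using (Rel)
open import Relation.Binary.Structures using (IsEquivalence)
import Relation.Binary.Reasoning.Setoid as SetoidReasoning

private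
  variable
    a ℓa b ℓb b′ ℓb′ c ℓ : Level

-- Duality and the two halves of the axioms.

dual : RawDoubleBooleanAlgebra c ℓ → RawDoubleBooleanAlgebra c ℓ
dual D = record
  { Carrier = Carrier ; _≈_ = _≈_
  ; _⊔_ = _⊓_ ; _⊓_ = _⊔_ ; ¬_ = ⌟_ ; ⌟_ = ¬_ ; ⊤ = ⊥ ; ⊥ = ⊤
  }
  where open RawDoubleBooleanAlgebra D

-- For `dual D` these fields are the join axioms of `D`, because `_∨_` of `dual D` unfolds to `_∧_`
-- of `D`. Axiom (12) mixes the two halves and is kept apart.
record IsMeetHalf (D : RawDoubleBooleanAlgebra c ℓ) : Set (c ⊔ˡ ℓ) where
  open RawDoubleBooleanAlgebra D
  field
    isEquivalence : IsEquivalence _≈_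
    ⊓-cong        : Congruent₂ _≈_ _⊓_
    ¬-cong        : Congruent₁ _≈_ ¬_
    ax1a  : ∀ x y → (x ⊓ x) ⊓ y ≈ x ⊓ y
    ax2a  : ∀ x y → x ⊓ y ≈ y ⊓ x
    ax3a  : ∀ x → ¬ (x ⊓ x) ≈ ¬ x
    ax4a  : ∀ x y → x ⊓ (x ⊔ y) ≈ x ⊓ x
    ax5a  : ∀ x y z → x ⊓ (y ∨ z) ≈ (x ⊓ y) ∨ (x ⊓ z)
    ax6a  : ∀ x y → x ⊓ (x ∨ y) ≈ x ⊓ x
    ax7a  : ∀ x y → ¬ (¬ (x ⊓ y)) ≈ x ⊓ y
    ax8a  : ∀ x → x ⊓ ¬ x ≈ ⊥
    ax9a  : ¬ ⊤ ≈ ⊥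
    ax10a : ∀ x y z → x ⊓ (y ⊓ z) ≈ (x ⊓ y) ⊓ z
    ax11a : ¬ ⊥ ≈ ⊤ ⊓ ⊤

module _ {D : RawDoubleBooleanAlgebra c ℓ} where
  open RawDoubleBooleanAlgebra D

  isMeetHalf : IsDoubleBooleanAlgebra D → IsMeetHalf D
  isMeetHalf isD = record
    { isEquivalence = isEquivalence ; ⊓-cong = ⊓-cong ; ¬-cong = ¬-cong
    ; ax1a = ax1a ; ax2a = ax2a ; ax3a = ax3a ; ax4a = ax4a ; ax5a = ax5a
    ; ax6a = ax6a ; ax7a = ax7a ; ax8a = ax8a ; ax9a = ax9a ; ax10a = ax10a
    ; ax11a = ax11a
    }
    where open IsDoubleBooleanAlgebra isD

  isJoinHalf : IsDoubleBooleanAlgebra D → IsMeetHalf (dual D)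
  isJoinHalf isD = record
    { isEquivalence = isEquivalence ; ⊓-cong = ⊔-cong ; ¬-cong = ⌟-cong
    ; ax1a = ax1b ; ax2a = ax2b ; ax3a = ax3b ; ax4a = ax4b ; ax5a = ax5b
    ; ax6a = ax6b ; ax7a = ax7b ; ax8a = ax8b ; ax9a = ax9b ; ax10a = ax10b
    ; ax11a = ax11b
    }
    where open IsDoubleBooleanAlgebra isD

  fromHalves : IsMeetHalf D → IsMeetHalf (dual D) →
               (∀ x → (x ⊓ x) ⊔ (x ⊓ x) ≈ (x ⊔ x) ⊓ (x ⊔ x)) →
               IsDoubleBooleanAlgebra D
  fromHalves M J ax12 = record
    { isEquivalence = M.isEquivalence
    ; ⊔-cong = J.⊓-cong ; ⊓-cong = M.⊓-cong ; ¬-cong = M.¬-cong ; ⌟-cong = J.¬-cong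
    ; ax1a = M.ax1a ; ax1b = J.ax1a ; ax2a = M.ax2a ; ax2b = J.ax2a
    ; ax3a = M.ax3a ; ax3b = J.ax3a ; ax4a = M.ax4a ; ax4b = J.ax4a
    ; ax5a = M.ax5a ; ax5b = J.ax5a ; ax6a = M.ax6a ; ax6b = J.ax6a
    ; ax7a = M.ax7a ; ax7b = J.ax7a ; ax8a = M.ax8a ; ax8b = J.ax8a
    ; ax9a = M.ax9a ; ax9b = J.ax9a ; ax10a = M.ax10a ; ax10b = J.ax10a
    ; ax11a = M.ax11a ; ax11b = J.ax11a ; ax12 = ax12
    }
    where
    module M = IsMeetHalf M
    module J = IsMeetHalf J

-- The Boolean algebra carried by the meet part.

module MeetAlgebra {D : RawDoubleBooleanAlgebra c ℓ} (half : IsMeetHalf D) where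
  open RawDoubleBooleanAlgebra D renaming (Carrier to ∣D∣) hiding (_∧_)
  open IsMeetHalf half
  open IsEquivalence isEquivalence

  setoid : Setoid c ℓ
  setoid = record { isEquivalence = isEquivalence }

  open SetoidReasoning setoid

  ⊓-squares : ∀ x y → (x ⊓ x) ⊓ (y ⊓ y) ≈ x ⊓ y
  ⊓-squares x y = begin
    (x ⊓ x) ⊓ (y ⊓ y)  ≈⟨ ax1a x (y ⊓ y) ⟩
    x ⊓ (y ⊓ y)        ≈⟨ ax2a x (y ⊓ y) ⟩
    (y ⊓ y) ⊓ x        ≈⟨ ax1a y x ⟩
    y ⊓ x              ≈⟨ ax2a y x ⟩
    x ⊓ y              ∎

  -- Regrouping brings equal factors next to each other, where `ax1a` merges them. A general element
  -- differs from its square, but a meet does not.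
  ⊓-idem : ∀ x y → (x ⊓ y) ⊓ (x ⊓ y) ≈ x ⊓ y
  ⊓-idem x y = begin
    (x ⊓ y) ⊓ (x ⊓ y)  ≈⟨ ax10a x y (x ⊓ y) ⟨
    x ⊓ (y ⊓ (x ⊓ y))  ≈⟨ ⊓-cong refl (⊓-cong refl (ax2a x y)) ⟩
    x ⊓ (y ⊓ (y ⊓ x))  ≈⟨ ⊓-cong refl (ax10a y y x) ⟩
    x ⊓ ((y ⊓ y) ⊓ x)  ≈⟨ ⊓-cong refl (ax1a y x) ⟩
    x ⊓ (y ⊓ x)        ≈⟨ ⊓-cong refl (ax2a y x) ⟩
    x ⊓ (x ⊓ y)        ≈⟨ ax10a x x y ⟩
    (x ⊓ x) ⊓ y        ≈⟨ ax1a x y ⟩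
    x ⊓ y              ∎

  ¬¬≈square : ∀ x → ¬ ¬ x ≈ x ⊓ x
  ¬¬≈square x = trans (¬-cong (sym (ax3a x))) (ax7a x x)

  -- Both sides equal the triple negation: `¬¬≈square` applies to its outer or to its inner pair.
  ¬-idem : ∀ x → ¬ x ⊓ ¬ x ≈ ¬ x
  ¬-idem x = begin
    ¬ x ⊓ ¬ x    ≈⟨ ¬¬≈square (¬ x) ⟨
    ¬ ¬ ¬ x      ≈⟨ ¬-cong (¬¬≈square x) ⟩
    ¬ (x ⊓ x)    ≈⟨ ax3a x ⟩
    ¬ x          ∎

  ⊥-idem : ⊥ ⊓ ⊥ ≈ ⊥
  ⊥-idem = trans (⊓-cong (sym ax9a) (sym ax9a)) (trans (¬-idem ⊤) ax9a)

  ¬-∨ : ∀ x y → ¬ (x ∨ y) ≈ ¬ x ⊓ ¬ y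
  ¬-∨ x y = ax7a (¬ x) (¬ y)

  -- Unfolding `∨` on the right leaves double negations, which are squares, and a meet depends only
  -- on the squares of its arguments.
  ¬-⊓ : ∀ x y → ¬ (x ⊓ y) ≈ ¬ x ∨ ¬ y
  ¬-⊓ x y = ¬-cong (sym (trans (⊓-cong (¬¬≈square x) (¬¬≈square y)) (⊓-squares x y)))

  ∨-comm : ∀ x y → x ∨ y ≈ y ∨ x
  ∨-comm x y = ¬-cong (ax2a (¬ x) (¬ y))

  ∨-assoc : ∀ x y z → (x ∨ y) ∨ z ≈ x ∨ (y ∨ z)
  ∨-assoc x y z = ¬-cong (begin
    ¬ (x ∨ y) ⊓ ¬ z      ≈⟨ ⊓-cong (¬-∨ x y) refl ⟩
    (¬ x ⊓ ¬ y) ⊓ ¬ z    ≈⟨ ax10a (¬ x) (¬ y) (¬ z) ⟨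
    ¬ x ⊓ (¬ y ⊓ ¬ z)    ≈⟨ ⊓-cong refl (¬-∨ y z) ⟨
    ¬ x ⊓ ¬ (y ∨ z)      ∎)

  -- De Morgan turns this absorption law into `ax6a` for the negations. The value is the square of
  -- `x`, hence `x` itself up to `∼`.
  ∨-absorbs-⊓ : ∀ x y → x ∨ (x ⊓ y) ≈ x ⊓ x
  ∨-absorbs-⊓ x y = begin
    ¬ (¬ x ⊓ ¬ (x ⊓ y))    ≈⟨ ¬-cong (⊓-cong refl (¬-⊓ x y)) ⟩
    ¬ (¬ x ⊓ (¬ x ∨ ¬ y))  ≈⟨ ¬-cong (ax6a (¬ x) (¬ y)) ⟩
    ¬ (¬ x ⊓ ¬ x)          ≈⟨ ax3a (¬ x) ⟩
    ¬ ¬ x                  ≈⟨ ¬¬≈square x ⟩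
    x ⊓ x                  ∎

  ∨-complementʳ : ∀ x → x ∨ ¬ x ≈ ⊤ ⊓ ⊤
  ∨-complementʳ x = trans (¬-cong (ax8a (¬ x))) ax11a

  infix 4 _∼_

  _∼_ : Rel ∣D∣ ℓ
  x ∼ y = x ⊓ x ≈ y ⊓ y

  ≈⇒∼ : ∀ {x y} → x ≈ y → x ∼ y
  ≈⇒∼ x≈y = ⊓-cong x≈y x≈y

  square∼ : ∀ x → x ⊓ x ∼ x
  square∼ x = ⊓-idem x x

  ≈square⇒∼ : ∀ {x y} → x ≈ y ⊓ y → x ∼ y
  ≈square⇒∼ {y = y} x≈yy = trans (≈⇒∼ x≈yy) (square∼ y)

  -- The conclusion is in `≈`, not merely in `∼`, so it can be used under `¬-cong`.
  ⊓-cong-∼ : ∀ {x x′ y y′} → x ∼ x′ → y ∼ y′ → x ⊓ y ≈ x′ ⊓ y′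
  ⊓-cong-∼ x∼x′ y∼y′ =
    trans (sym (⊓-squares _ _)) (trans (⊓-cong x∼x′ y∼y′) (⊓-squares _ _))

  ¬-cong-∼ : ∀ {x y} → x ∼ y → ¬ x ≈ ¬ y
  ¬-cong-∼ x∼y = trans (sym (ax3a _)) (trans (¬-cong x∼y) (ax3a _))

  -- Among the distributive laws (5a) is meet over join, whereas the biased
  -- constructor asks for join over meet: hence the lattice is built upside down.
  ⊓-∨-isBooleanAlgebra : IsBooleanAlgebra _∼_ _⊓_ _∨_ ¬_ ⊥ ⊤
  ⊓-∨-isBooleanAlgebra = isBooleanAlgebraʳ record
    { isDistributiveLattice = isDistributiveLatticeʳʲᵐ record
      { isLattice = record
        { isEquivalence = record { refl = refl ; sym = sym ; trans = trans }
        ; ∨-comm     = λ x y → ≈⇒∼ (ax2a x y)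
        ; ∨-assoc    = λ x y z → ≈⇒∼ (sym (ax10a x y z))
        ; ∨-cong     = λ p q → ≈⇒∼ (⊓-cong-∼ p q)
        ; ∧-comm     = λ x y → ≈⇒∼ (∨-comm x y)
        ; ∧-assoc    = λ x y z → ≈⇒∼ (∨-assoc x y z)
        ; ∧-cong     = λ p q → ≈⇒∼ (¬-cong (⊓-cong (¬-cong-∼ p) (¬-cong-∼ q)))
        ; absorptive = (λ x y → ≈square⇒∼ (ax6a x y))
                     , (λ x y → ≈square⇒∼ (∨-absorbs-⊓ x y))
        }
      ; ∨-distribʳ-∧ = λ x y z → ≈⇒∼ (begin
          (y ∨ z) ⊓ x          ≈⟨ ax2a (y ∨ z) x ⟩
          x ⊓ (y ∨ z)          ≈⟨ ax5a x y z ⟩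
          (x ⊓ y) ∨ (x ⊓ z)    ≈⟨ ¬-cong (⊓-cong (¬-cong (ax2a x y)) (¬-cong (ax2a x z))) ⟩
          (y ⊓ x) ∨ (z ⊓ x)    ∎)
      }
    ; ∨-complementʳ = λ x → ≈⇒∼ (ax8a x)
    ; ∧-complementʳ = λ x → ≈square⇒∼ (∨-complementʳ x)
    ; ¬-cong        = λ p → ≈⇒∼ (¬-cong-∼ p)
    }

  -- Its join is `⊓` and its top is `⊥`. Taken over `dual D`, its join is therefore `⊔` of `D` and
  -- its top is `⊤` of `D`, the orientation wanted for the second algebra.
  dualBooleanAlgebra : BooleanAlgebra c ℓ
  dualBooleanAlgebra = record { isBooleanAlgebra = ⊓-∨-isBooleanAlgebra }

  booleanAlgebra : BooleanAlgebra c ℓ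
  booleanAlgebra = BooleanAlgebraProperties.∧-∨-booleanAlgebra dualBooleanAlgebra

  project : Func setoid (BooleanAlgebra.setoid booleanAlgebra)
  project = record { to = λ x → x ; cong = ≈⇒∼ }

  -- Congruence is the identity because `∼` is by definition equality of squares.
  square : Func (BooleanAlgebra.setoid booleanAlgebra) setoid
  square = record { to = λ x → x ⊓ x ; cong = λ x∼y → x∼y }

-- The meet half of the constructed algebra.

module ResultMeet
  (A : Setoid a ℓa) (B : BooleanAlgebra b ℓb) (B′ : BooleanAlgebra b′ ℓb′)
  (rᶠ : Func A (BooleanAlgebra.setoid B)) (eᶠ : Func (BooleanAlgebra.setoid B) A)
  (r′ᶠ : Func A (BooleanAlgebra.setoid B′)) (e′ᶠ : Func (BooleanAlgebra.setoid B′) A)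
  (retractions : Construction.AreRetractions A B B′ rᶠ eᶠ r′ᶠ e′ᶠ)
  where

  open Construction A B B′ rᶠ eᶠ r′ᶠ e′ᶠ
  open Func rᶠ using () renaming (to to r; cong to r-cong)
  open Func eᶠ using () renaming (to to e; cong to e-cong)
  open Func r′ᶠ using () renaming (to to r′)
  open Func e′ᶠ using () renaming (to to e′; cong to e′-cong)
  open AreRetractions retractions
  private module A = Setoid A
  open BooleanAlgebra B
  open BooleanAlgebraProperties B
    using (∧-idem; deMorgan₁; ¬-involutive; ¬⊥≈⊤; ¬⊤≈⊥)
  private module R = RawDoubleBooleanAlgebra result
  open SetoidReasoning setoid

  e-injective : ∀ {p q} → e p A.≈ e q → p ≈ q
  e-injective {p} {q} ep≈eq = begin
    p        ≈⟨ r∘e≈id p ⟨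
    r (e p)  ≈⟨ r-cong ep≈eq ⟩
    r (e q)  ≈⟨ r∘e≈id q ⟩
    q        ∎

  e-∧-idem : ∀ x → x R.⊓ x A.≈ e (r x)
  e-∧-idem x = e-cong (∧-idem (r x))

  -- This reduces `ax5a` and `ax6a` of the result to distributivity and absorption in `B`.
  r-∨ : ∀ x y → r (x R.∨ y) ≈ r x ∨ r y
  r-∨ x y = begin
    r (x R.∨ y)                        ≈⟨ r∘e≈id _ ⟩
    ¬ (r (e (¬ r x) R.⊓ e (¬ r y)))    ≈⟨ ¬-cong (r∘e≈id _) ⟩
    ¬ (r (e (¬ r x)) ∧ r (e (¬ r y)))  ≈⟨ ¬-cong (∧-cong (r∘e≈id _) (r∘e≈id _)) ⟩
    ¬ (¬ r x ∧ ¬ r y)                  ≈⟨ deMorgan₁ _ _ ⟩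
    ¬ ¬ r x ∨ ¬ ¬ r y                  ≈⟨ ∨-cong (¬-involutive _) (¬-involutive _) ⟩
    r x ∨ r y                          ∎

  -- In `ax11a` the left side computes to `e ⊤` and the right side to `e (r R.⊤)`; injectivity of
  -- `e` then gives one half of condition (c).
  r-⊤ : IsMeetHalf result → r R.⊤ ≈ ⊤
  r-⊤ half = e-injective (A.trans (A.sym (e-∧-idem R.⊤))
    (A.trans (A.sym (IsMeetHalf.ax11a half))
             (e-cong (trans (¬-cong (r∘e≈id ⊥)) ¬⊥≈⊤))))

  -- The conditions enter at three axioms: `b-⊓` gives `ax4a`, and `c-⊤` gives `ax9a` and `ax11a`.
  -- The others come from Boolean laws after cancelling `r` against `e`.
  resultMeetHalf : Conditions → IsMeetHalf result
  resultMeetHalf C = record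
    { isEquivalence = A.isEquivalence
    ; ⊓-cong = λ p q → e-cong (∧-cong (r-cong p) (r-cong q))
    ; ¬-cong = λ p → e-cong (¬-cong (r-cong p))
    ; ax1a  = λ x y → e-cong (∧-congʳ (r-square x))
    ; ax2a  = λ x y → e-cong (∧-comm (r x) (r y))
    ; ax3a  = λ x → e-cong (¬-cong (r-square x))
    ; ax4a  = λ x y → A.trans (b-⊓ x y) (A.sym (e-∧-idem x))
    ; ax5a  = λ x y z → e-cong (begin
        r x ∧ r (y R.∨ z)                  ≈⟨ ∧-congˡ (r-∨ y z) ⟩
        r x ∧ (r y ∨ r z)                  ≈⟨ ∧-distribˡ-∨ _ _ _ ⟩
        r x ∧ r y ∨ r x ∧ r z              ≈⟨ ∨-cong (r∘e≈id _) (r∘e≈id _) ⟨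
        r (x R.⊓ y) ∨ r (x R.⊓ z)          ≈⟨ r-∨ _ _ ⟨
        r ((x R.⊓ y) R.∨ (x R.⊓ z))        ≈⟨ r∘e≈id _ ⟩
        ¬ r (R.¬ (x R.⊓ y) R.⊓ R.¬ (x R.⊓ z)) ∎)
    ; ax6a  = λ x y → e-cong (begin
        r x ∧ r (x R.∨ y)                  ≈⟨ ∧-congˡ (r-∨ x y) ⟩
        r x ∧ (r x ∨ r y)                  ≈⟨ ∧-absorbs-∨ _ _ ⟩
        r x                                ≈⟨ ∧-idem (r x) ⟨
        r x ∧ r x                          ∎)
    ; ax7a  = λ x y → e-cong (begin
        ¬ r (e (¬ r (x R.⊓ y)))            ≈⟨ ¬-cong (r∘e≈id _) ⟩
        ¬ ¬ r (x R.⊓ y)                    ≈⟨ ¬-involutive _ ⟩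
        r (x R.⊓ y)                        ≈⟨ r∘e≈id _ ⟩
        r x ∧ r y                          ∎)
    ; ax8a  = λ x → e-cong (trans (∧-congˡ (r∘e≈id _)) (∧-complementʳ (r x)))
    ; ax9a  = e-cong (trans (¬-cong c-⊤) ¬⊤≈⊥)
    ; ax10a = λ x y z → e-cong (begin
        r x ∧ r (y R.⊓ z)                  ≈⟨ ∧-congˡ (r∘e≈id _) ⟩
        r x ∧ (r y ∧ r z)                  ≈⟨ ∧-assoc _ _ _ ⟨
        (r x ∧ r y) ∧ r z                  ≈⟨ ∧-congʳ (r∘e≈id _) ⟨
        r (x R.⊓ y) ∧ r z                  ∎)
    ; ax11a = e-cong (begin
        ¬ r (e ⊥)                          ≈⟨ ¬-cong (r∘e≈id ⊥) ⟩
        ¬ ⊥                                ≈⟨ ¬⊥≈⊤ ⟩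
        ⊤                                  ≈⟨ c-⊤ ⟨
        r R.⊤                              ≈⟨ ∧-idem _ ⟨
        r R.⊤ ∧ r R.⊤                      ∎)
    }
    where
    open Conditions C
    r-square : ∀ x → r (x R.⊓ x) ≈ r x
    r-square x = trans (r∘e≈id _) (∧-idem (r x))

  -- Together with its dual, this identifies the two sides of `ax12` with the two composites in
  -- condition (a).
  er-⊔ : ∀ x → (x R.⊔ x) R.⊓ (x R.⊔ x) A.≈ e (r (e′ (r′ x)))
  er-⊔ x = A.trans (e-∧-idem _)
    (e-cong (r-cong (e′-cong (BooleanAlgebraProperties.∨-idem B′ (r′ x)))))

-- The conditions are equivalent to the axioms.

module _
  (A : Setoid a ℓa) (B : BooleanAlgebra b ℓb) (B′ : BooleanAlgebra b′ ℓb′)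
  (r : Func A (BooleanAlgebra.setoid B)) (e : Func (BooleanAlgebra.setoid B) A)
  (r′ : Func A (BooleanAlgebra.setoid B′)) (e′ : Func (BooleanAlgebra.setoid B′) A)
  (retractions : Construction.AreRetractions A B B′ r e r′ e′)
  where

  open Construction A B B′ r e r′ e′

  private
    module A = Setoid A
    -- Exchanging the two sides and reversing both Boolean algebras makes `Op.result` definitionally
    -- `dual result`, so `J` supplies the join half.
    opB opB′ : BooleanAlgebra _ _
    opB  = BooleanAlgebraProperties.∧-∨-booleanAlgebra B
    opB′ = BooleanAlgebraProperties.∧-∨-booleanAlgebra B′
    module Op = Construction A opB′ opB r′ e′ r e

    retractionsᵒᵖ : Op.AreRetractions
    retractionsᵒᵖ = record { r∘e≈id = r′∘e′≈id ; r′∘e′≈id = r∘e≈id }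
      where open AreRetractions retractions

    module M = ResultMeet A B B′ r e r′ e′ retractions
    module J = ResultMeet A opB′ opB r′ e′ r e retractionsᵒᵖ

  conditions⇒isDBA : Conditions → IsDoubleBooleanAlgebra result
  conditions⇒isDBA C = fromHalves
    (M.resultMeetHalf C)
    (J.resultMeetHalf Cᵒᵖ)
    (λ x → A.trans (J.er-⊔ x)
      (A.trans (A.sym (a-comm x)) (A.sym (M.er-⊔ x))))
    where
    open Conditions C
    Cᵒᵖ : Op.Conditions
    Cᵒᵖ = record
      { a-comm = λ x → A.sym (a-comm x)
      ; b-⊓ = b-⊔ ; b-⊔ = b-⊓ ; c-⊤ = c-⊥ ; c-⊥ = c-⊤
      }

  isDBA⇒conditions : IsDoubleBooleanAlgebra result → Conditions
  isDBA⇒conditions isD = record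
    { a-comm = λ x → A.trans (A.sym (M.er-⊔ x))
        (A.trans (A.sym (ax12 x)) (J.er-⊔ x))
    ; b-⊓ = λ x y → A.trans (ax4a x y) (M.e-∧-idem x)
    ; b-⊔ = λ x y → A.trans (ax4b x y) (J.e-∧-idem x)
    ; c-⊤ = M.r-⊤ (isMeetHalf isD)
    ; c-⊥ = J.r-⊤ (isJoinHalf isD)
    }
    where open IsDoubleBooleanAlgebra isD

-- Every double Boolean algebra arises from the construction.

module Representation (D : DoubleBooleanAlgebra c ℓ) where
  open DoubleBooleanAlgebra D
  open IsEquivalence isEquivalence
  module M = MeetAlgebra (isMeetHalf isDoubleBooleanAlgebra)
  module J = MeetAlgebra (isJoinHalf isDoubleBooleanAlgebra)

  open Construction setoid M.booleanAlgebra J.dualBooleanAlgebra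
    M.project M.square J.project J.square

  areRetractions : AreRetractions
  areRetractions = record { r∘e≈id = M.square∼ ; r′∘e′≈id = J.square∼ }

  conditions : Conditions
  conditions = record
    -- Both `r` and `r′` are identities and `e`, `e′` are the two squarings, so condition (a) is
    -- `ax12` read backwards.
    { a-comm = λ x → sym (ax12 x)
    -- The inner `e′` squares `x ⊔ y`, which changes nothing, and `ax4a` then applies.
    ; b-⊓ = λ x y → M.≈square⇒∼ (trans (⊓-cong refl (J.⊓-idem x y)) (ax4a x y))
    ; b-⊔ = λ x y → J.≈square⇒∼ (trans (⊔-cong refl (M.⊓-idem x y)) (ax4b x y))
    ; c-⊤ = M.≈⇒∼ J.⊥-idem
    ; c-⊥ = J.≈⇒∼ M.⊥-idem
    }

  -- The constructed operations are the squares of those of `D`, whose values all equal their own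
  -- squares.
  recovers : Recovers D M.booleanAlgebra J.dualBooleanAlgebra
               M.project M.square J.project J.square
  recovers = record
    { ⊓-eq = λ x y → sym (M.⊓-idem x y)
    ; ⊔-eq = λ x y → sym (J.⊓-idem x y)
    ; ¬-eq = λ x → sym (M.¬-idem x)
    ; ⌟-eq = λ x → sym (J.¬-idem x)
    ; ⊤-eq = sym J.⊥-idem
    ; ⊥-eq = sym M.⊥-idem
    }

theorem5p5 : ∀ {a ℓa b ℓb b′ ℓb′ c ℓ : Level} →
    ( (A : Setoid a ℓa) (B : BooleanAlgebra b ℓb) (B′ : BooleanAlgebra b′ ℓb′)
    (r : Func A (BooleanAlgebra.setoid B)) (e : Func (BooleanAlgebra.setoid B) A)
    (r′ : Func A (BooleanAlgebra.setoid B′)) (e′ : Func (BooleanAlgebra.setoid B′) A) →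
    Construction.AreRetractions A B B′ r e r′ e′ →
    IsDoubleBooleanAlgebra (Construction.result A B B′ r e r′ e′)
    ⇔ Construction.Conditions A B B′ r e r′ e′ )
    ×
    ( (D : DoubleBooleanAlgebra c ℓ) →
    Σ[ B ∈ BooleanAlgebra c ℓ ] Σ[ B′ ∈ BooleanAlgebra c ℓ ]
    Σ[ r ∈ Func (DoubleBooleanAlgebra.setoid D) (BooleanAlgebra.setoid B) ]
    Σ[ e ∈ Func (BooleanAlgebra.setoid B) (DoubleBooleanAlgebra.setoid D) ]
    Σ[ r′ ∈ Func (DoubleBooleanAlgebra.setoid D) (BooleanAlgebra.setoid B′) ]
    Σ[ e′ ∈ Func (BooleanAlgebra.setoid B′) (DoubleBooleanAlgebra.setoid D) ]
    ( Construction.AreRetractions (DoubleBooleanAlgebra.setoid D) B B′ r e r′ e′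
    × Construction.Conditions (DoubleBooleanAlgebra.setoid D) B B′ r e r′ e′
    × Recovers D B B′ r e r′ e′ ) )
theorem5p5 =
  ( λ A B B′ r e r′ e′ retractions →
      mk⇔ (isDBA⇒conditions A B B′ r e r′ e′ retractions)
          (conditions⇒isDBA A B B′ r e r′ e′ retractions) ) ,
  λ D → let open Representation D in
    M.booleanAlgebra , J.dualBooleanAlgebra ,
    M.project , M.square , J.project , J.square ,
    areRetractions , conditions , recovers
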